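{- Let $K_{m,n}$ be the complete bipartite graph with bipartition $(X,Y)$, $|X|=m$, $|Y|=n$. Let $T$ be any tree which is a subgraph of $K_{m,n}$, and put $s=|V(T)\cap X|$, $t=|V(T)\cap Y|$. Then the number $\tau_T(K_{m,n})$ of spanning trees of $K_{m,n}$ containing all edges of $T$ is $$\tau_T(K_{m,n})=(sn+tm-st)\,m^{n-t-1}n^{m-s-1}.$$
   Context: For a subgraph $H$ of a graph $G$, $\tau_H(G)$ denotes the number of spanning trees of $G$ containing all edges of $H$. -}

module Defs where

open import Data.Nat using (ℕ; _≤_)
open import Data.Fin using (Fin)
open import Data.Fin.Subset using (Subset; _∈_)
open import Data.Bool using (Bool; true)
open import Data.Vec using (Vec; lookup)
open import Data.Sum using (_⊎_; inj₁; inj₂)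
open import Data.Product using (_×_; Σ; ∃)
open import Data.Empty using (⊥)
open import Data.List using (List; []; _∷_; _++_; [_]; length)
open import Data.List.Relation.Unary.Linked using (Linked)
open import Data.List.Relation.Unary.Unique.Propositional using (Unique)
import Data.List.Membership.Propositional as LM
open import Relation.Binary.PropositionalEquality using (_≡_)
open import Relation.Binary.Construct.Closure.ReflexiveTransitive using (Star)
open import Relation.Nullary using (¬_)
open import Function.Bundles using (_⇔_)

Vertex : ℕ → ℕ → Set
Vertex m n = Fin m ⊎ Fin n

-- A set of edges of K_{m,n}; the edge {x_i, y_j} is present iff entry (i,j) is true.
EdgeSet : ℕ → ℕ → Set
EdgeSet m n = Vec (Vec Bool n) m

HasEdge : ∀ {m n} → EdgeSet m n → Fin m → Fin n → Set
HasEdge E i j = lookup (lookup E i) j ≡ true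

Adj : ∀ {m n} → EdgeSet m n → Vertex m n → Vertex m n → Set
Adj E (inj₁ i) (inj₂ j) = HasEdge E i j
Adj E (inj₂ j) (inj₁ i) = HasEdge E i j
Adj E (inj₁ _) (inj₁ _) = ⊥
Adj E (inj₂ _) (inj₂ _) = ⊥

Reachable : ∀ {m n} → EdgeSet m n → Vertex m n → Vertex m n → Set
Reachable E = Star (Adj E)

HasCycle : ∀ {m n} → EdgeSet m n → Set
HasCycle {m} {n} E =
  Σ (Vertex m n) λ v → Σ (List (Vertex m n)) λ vs →
    (2 ≤ length vs) × Unique (v ∷ vs) × Linked (Adj E) ((v ∷ vs) ++ [ v ])

Acyclic : ∀ {m n} → EdgeSet m n → Set
Acyclic E = ¬ HasCycle E

-- A subgraph H = (V(H), E(H)) of K_{m,n}: V(H) = VX ∪ VY, E(H) = E,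
-- with every edge having both endpoints in V(H).
InV : ∀ {m n} → Subset m → Subset n → Vertex m n → Set
InV VX VY (inj₁ i) = i ∈ VX
InV VX VY (inj₂ j) = j ∈ VY

IsSubgraph : ∀ {m n} → Subset m → Subset n → EdgeSet m n → Set
IsSubgraph {m} {n} VX VY E = ∀ (i : Fin m) (j : Fin n) → HasEdge E i j → (i ∈ VX) × (j ∈ VY)

IsTree : ∀ {m n} → Subset m → Subset n → EdgeSet m n → Set
IsTree {m} {n} VX VY E =
  IsSubgraph VX VY E ×
  (∃ λ (v : Vertex m n) → InV VX VY v) ×
  (∀ u v → InV VX VY u → InV VX VY v → Reachable E u v) ×
  Acyclic E

IsSpanningTree : ∀ {m n} → EdgeSet m n → Set
IsSpanningTree E = (∀ u v → Reachable E u v) × Acyclic E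

_⊆ₑ_ : ∀ {m n} → EdgeSet m n → EdgeSet m n → Set
_⊆ₑ_ {m} {n} E F = ∀ (i : Fin m) (j : Fin n) → HasEdge E i j → HasEdge F i j

HasCardinality : ∀ {m n} → (EdgeSet m n → Set) → ℕ → Set
HasCardinality {m} {n} P N =
  Σ (List (EdgeSet m n)) λ L →
    Unique L × (∀ S → (S LM.∈ L) ⇔ P S) × (length L ≡ N)

TauIs : ∀ {m n} → EdgeSet m n → ℕ → Set
TauIs ET N = HasCardinality (λ S → IsSpanningTree S × (ET ⊆ₑ S)) N

{-# OPTIONS --safe #-}

-- Deletion–contraction.  Fix a tree T on X′ ∪ Y′ and a set A of allowed edges containing T and
-- every edge between X ∖ X′ and Y ∖ Y′.  The number of spanning trees between T and A is
--
--   ∏ deg x · ∏ deg y  −  (Σ_x ∏_{x′ ≠ x} deg x′) · (Σ_y ∏_{y′ ≠ y} deg y′),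
--
-- where x, x′ range over X ∖ X′, y, y′ over Y ∖ Y′, and deg is the degree in A.  Let xy ∈ A with
-- x ∈ X′ and y ∉ Y′.  A tree using xy contains T + xy, which only removes y from the index set; a
-- tree avoiding xy lies in A − xy, which only lowers deg y by one.  The formula is additive under
-- this split because it is affine in deg y, with slope the formula for T + xy.  If A has no edge leaving T, all free degrees on a
-- side agree, and the formula gives 0, or 1 if T is spanning.  For A = K_{m,n} the degrees are n
-- on X and m on Y.
module Submission where

open import Defs
open import Data.Nat using (ℕ; _+_; _*_; _∸_; _^_; _≤_)
open import Data.Fin.Subset using (Subset; ∣_∣)
open import Data.Product using (Σ; _×_)
open import Relation.Binary.PropositionalEquality using (_≡_)

open import Data.Bool using (Bool; true; false; not)
import Data.Bool.Properties as Bool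
open import Data.Nat using (zero; suc; _<_; s≤s)
open import Data.Nat.Properties
open import Data.Nat.Tactic.RingSolver using (solve-∀)
open import Data.Fin using (Fin; zero; suc)
import Data.Fin.Properties as Fin
open import Data.Fin.Subset using (_∈_; _∉_; ∁)
open import Data.Fin.Subset.Properties using (_∈?_; ∣∁p∣≡n∸∣p∣; ∣p∣≤n; x∉p⇒x∈∁p; drop-there)
open import Data.Vec using ([]; _∷_; lookup; tabulate; replicate; _[_]≔_; here; there)
import Data.Vec.Properties as Vec
open import Data.Vec.Relation.Binary.Pointwise.Extensional using (ext; Pointwise-≡⇒≡)
open import Data.Sum using (_⊎_; inj₁; inj₂; [_,_]′)
import Data.Sum as Sum
import Data.Sum.Properties as Sum
open import Data.Product using (∃; _,_; proj₁; proj₂)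
open import Data.Empty using (⊥-elim)
open import Data.List using (List; []; _∷_; _++_; [_]; length; initLast; _∷ʳ′_)
open import Data.List.Properties using (++-assoc; length-++)
open import Data.List.Relation.Unary.All using (All; []; _∷_)
import Data.List.Relation.Unary.All as All
import Data.List.Relation.Unary.All.Properties as All
open import Data.List.Relation.Unary.Any using (here; there)
open import Data.List.Relation.Unary.AllPairs using ([]; _∷_)
open import Data.List.Relation.Unary.Linked using (Linked; []; [-]; _∷_)
import Data.List.Relation.Unary.Linked as Linked
open import Data.List.Relation.Unary.Unique.Propositional using (Unique)
import Data.List.Relation.Unary.Unique.Propositional.Properties as Unique
import Data.List.Membership.Propositional as List
import Data.List.Membership.Propositional.Properties as List
import Data.List.Membership.DecPropositional as DecMembership
open import Function using (_∘_; id)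
open import Function.Bundles using (mk⇔; Equivalence)
open import Relation.Binary.Core using (Rel)
open import Relation.Binary.Definitions using (DecidableEquality)
open import Relation.Binary.PropositionalEquality using (_≢_; refl; sym; trans; cong; cong₂; subst; module ≡-Reasoning)
open import Relation.Binary.Construct.Closure.ReflexiveTransitive using (Star; ε; _◅_; _◅◅_)
import Relation.Binary.Construct.Closure.ReflexiveTransitive as Star
open import Relation.Nullary using (¬_; Dec; yes; no; contradiction; _×-dec_; ¬?)
open import Level using (0ℓ)

-- Paths and cycles of a relation

Cycle : {V : Set} → Rel V 0ℓ → Set
Cycle {V} R = Σ V λ v → Σ (List V) λ vs →
  (2 ≤ length vs) × Unique (v ∷ vs) × Linked R ((v ∷ vs) ++ [ v ])

module _ {V : Set} {R : Rel V 0ℓ} where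

  linked-at : ∀ xs {a b ys} → Linked R (xs ++ a ∷ b ∷ ys) → R a b
  linked-at []       (r ∷ _) = r
  linked-at (x ∷ xs) l       = linked-at xs (Linked.tail l)

  linked-suffix : ∀ xs {ys} → Linked R (xs ++ ys) → Linked R ys
  linked-suffix []       l = l
  linked-suffix (x ∷ xs) l = linked-suffix xs (Linked.tail l)

  linked-snoc : ∀ xs {a b} → Linked R (xs ++ [ a ]) → R a b → Linked R ((xs ++ [ a ]) ++ [ b ])
  linked-snoc []           l       r = r ∷ [-]
  linked-snoc (x ∷ [])     (s ∷ l) r = s ∷ linked-snoc [] l r
  linked-snoc (x ∷ y ∷ xs) (s ∷ l) r = s ∷ linked-snoc (y ∷ xs) l r

module _ {V : Set} where

  unique-suffix : ∀ (xs : List V) {ys} → Unique (xs ++ ys) → Unique ys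
  unique-suffix []       p       = p
  unique-suffix (x ∷ xs) (_ ∷ p) = unique-suffix xs p

  unique-apart : ∀ (xs : List V) {a b ys} → Unique (xs ++ a ∷ ys) → b List.∈ ys → a ≢ b
  unique-apart xs p b∈ys with unique-suffix xs p
  ... | a≢ ∷ _ = All.lookup a≢ b∈ys

  linked-restrict : ∀ {R R′ : Rel V 0ℓ} {P : V → Set} → (∀ {x y} → P x → P y → R′ x y → R x y) →
    ∀ {xs} → All P xs → Linked R′ xs → Linked R xs
  linked-restrict f _            []      = []
  linked-restrict f _            [-]     = [-]
  linked-restrict f (p ∷ q ∷ ps) (r ∷ l) = f p q r ∷ linked-restrict f (q ∷ ps) l

  -- On a cycle through `w`, the vertices just before and just after `w` are both forced to be `u`.
  -- A cycle has at least three vertices, so these two are distinct entries of a duplicate-free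
  -- list.
  leaf∉cycle : ∀ {R : Rel V 0ℓ} {u w v vs} →
    (∀ {a} → R a w → a ≡ u) → (∀ {b} → R w b → b ≡ u) →
    2 ≤ length vs → Unique (v ∷ vs) → Linked R ((v ∷ vs) ++ [ v ]) → ¬ (w List.∈ v ∷ vs)
  -- Here `w` is the base of the cycle: its successor is `b`, and its predecessor is the last listed
  -- vertex `z`, read off the closing edge. The length bound makes `b` and `z` different positions.
  leaf∉cycle {w = w} {vs = b ∷ vs} pred succ (s≤s 1≤) uniq l (here refl) with initLast vs | 1≤
  ... | ys ∷ʳ′ z | _ =
    unique-apart [ _ ] uniq (List.∈-++⁺ʳ ys (here refl))
      (trans (succ (linked-at [] l))
        (sym (pred (linked-at (w ∷ b ∷ ys) (subst (λ xs → Linked _ (w ∷ b ∷ xs)) (++-assoc ys [ z ] _) l)))))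
  leaf∉cycle {w = w} {v = v} {vs = vs} pred succ 2≤ uniq l (there w∈) with List.∈-∃++ w∈
  -- The cycle is cut at `w`. An empty left part makes the base `v` the predecessor, an empty right
  -- part makes it the successor; both empty is excluded by the length.
  ... | l₁ , l₂ , refl rewrite ++-assoc l₁ (w ∷ l₂) [ v ] with initLast l₁ | l₂
  leaf∉cycle pred succ (s≤s ()) uniq l (there w∈) | _ , _ , refl | [] | []
  ... | [] | b ∷ l₃ = unique-apart [] uniq (there (here refl))
        (trans (pred (linked-at [] l)) (sym (succ (linked-at [ v ] l))))
  ... | ys ∷ʳ′ z | [] = unique-apart [] uniq (List.∈-++⁺ˡ (List.∈-++⁺ʳ ys (here refl)))
        (trans (succ (linked-at (v ∷ ys ++ [ z ]) l))
          (sym (pred (linked-at (v ∷ ys) (subst (Linked _ ∘ (v ∷_)) (++-assoc ys [ z ] _) l)))))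
  ... | ys ∷ʳ′ z | b ∷ l₃ =
        unique-apart (v ∷ ys) (subst (Unique ∘ (v ∷_)) (++-assoc ys [ z ] _) uniq) (there (here refl))
          (trans (pred (linked-at (v ∷ ys) (subst (Linked _ ∘ (v ∷_)) (++-assoc ys [ z ] _) l)))
            (sym (succ (linked-at (v ∷ ys ++ [ z ]) l))))

module _ {V : Set} (_≟_ : DecidableEquality V) where
  open DecMembership _≟_ using () renaming (_∈?_ to _∈ₗ?_)

  -- Only the interior vertices `ws` are a witness, with both ends kept visible, so that one further
  -- edge from `v` to `u` gives exactly the list shape required by `Cycle`.
  SimplePath : Rel V 0ℓ → V → V → Set
  SimplePath R u v = ∃ λ ws → Unique (u ∷ ws ++ [ v ]) × Linked R (u ∷ ws ++ [ v ])

  -- Loop erasure: the tail from `u′` is first made simple, and if `u` already lies on it,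
  -- everything before that occurrence is dropped.
  simplePath : ∀ {R : Rel V 0ℓ} {u v} → u ≢ v → Star R u v → SimplePath R u v
  simplePath u≢v ε = contradiction refl u≢v
  simplePath {u = u} {v} u≢v (_◅_ {j = u′} r rs) with u′ ≟ v
  ... | yes refl = [] , (u≢v ∷ []) ∷ ([] ∷ []) , r ∷ [-]
  ... | no u′≢v with simplePath u′≢v rs
  ... | ws , uniq , l with u ∈ₗ? (u′ ∷ ws)
  ... | no u∉ = u′ ∷ ws ,
    All.++⁺ (All.¬Any⇒All¬ (u′ ∷ ws) u∉) (u≢v ∷ []) ∷ uniq , r ∷ l
  ... | yes u∈ with List.∈-∃++ u∈
  ... | ys , zs , eq = zs , unique-suffix ys (subst Unique split uniq) ,
                            linked-suffix ys (subst (Linked _) split l)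
    where
    split : (u′ ∷ ws) ++ [ v ] ≡ ys ++ u ∷ zs ++ [ v ]
    split = trans (cong (_++ [ v ]) eq) (++-assoc ys (u ∷ zs) [ v ])

  closingEdge-cycle : ∀ {R S : Rel V 0ℓ} {u v} → u ≢ v → Star R u v → ¬ R u v →
    (∀ {x y} → R x y → S x y) → S v u → Cycle S
  closingEdge-cycle {u = u} {v} u≢v path ¬Ruv R⊆S Svu with simplePath u≢v path
  -- An empty interior would be a single edge from `u` to `v` in `R`, which is excluded; hence the
  -- closed list has the third vertex that a cycle demands.
  ... | [] , _ , r ∷ _ = contradiction r ¬Ruv
  ... | w ∷ ws , uniq , l = u , w ∷ ws ++ [ v ] ,
    s≤s (subst (1 ≤_) (sym (length-++ ws)) (m≤n+m 1 (length ws))) , uniq ,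
    linked-snoc (u ∷ w ∷ ws) (Linked.map R⊆S l) Svu

  -- The only possible neighbour of `w` in `R′` is `u`, so a cycle of `R′` avoids `w` by
  -- `leaf∉cycle`. All its edges are then old, and it is already a cycle of `R`.
  addLeaf-acyclic : ∀ {R R′ : Rel V 0ℓ} {u w} →
    (∀ {x} → ¬ R x w) → (∀ {x} → ¬ R w x) →
    (∀ {x y} → R′ x y → R x y ⊎ (x ≡ u × y ≡ w) ⊎ (x ≡ w × y ≡ u)) →
    ¬ Cycle R → ¬ Cycle R′
  addLeaf-acyclic {R} {R′} {u} {w} ¬Rw ¬wR new acyc (v , vs , 2≤ , uniq , l) =
    acyc (v , vs , 2≤ , uniq , linked-restrict old avoid l)
    where
    pred : ∀ {a} → R′ a w → a ≡ u
    pred r with new r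
    ... | inj₁ r′                 = contradiction r′ ¬Rw
    ... | inj₂ (inj₁ (p , _))     = p
    ... | inj₂ (inj₂ (p , q))     = trans p q
    succ : ∀ {b} → R′ w b → b ≡ u
    succ r with new r
    ... | inj₁ r′                 = contradiction r′ ¬wR
    ... | inj₂ (inj₁ (p , q))     = trans q p
    ... | inj₂ (inj₂ (_ , q))     = q
    w∉ : ¬ (w List.∈ v ∷ vs)
    w∉ = leaf∉cycle pred succ 2≤ uniq l
    avoid : All (w ≢_) ((v ∷ vs) ++ [ v ])
    avoid = All.++⁺ (All.¬Any⇒All¬ _ w∉) ((w∉ ∘ here) ∷ [])
    old : ∀ {x y} → w ≢ x → w ≢ y → R′ x y → R x y
    old w≢x w≢y r with new r
    ... | inj₁ r′             = r′
    ... | inj₂ (inj₁ (_ , q)) = contradiction (sym q) w≢y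
    ... | inj₂ (inj₂ (p , _)) = contradiction (sym p) w≢x

-- Weights outside a subset

prodOff : ∀ {k} → Subset k → (Fin k → ℕ) → ℕ
prodOff []          f = 1
prodOff (true ∷ Q)  f = prodOff Q (f ∘ suc)
prodOff (false ∷ Q) f = f zero * prodOff Q (f ∘ suc)

-- Σ_{i ∉ Q} ∏_{l ∉ Q, l ≠ i} f l
omitOff : ∀ {k} → Subset k → (Fin k → ℕ) → ℕ
omitOff []          f = 0
omitOff (true ∷ Q)  f = omitOff Q (f ∘ suc)
omitOff (false ∷ Q) f = f zero * omitOff Q (f ∘ suc) + prodOff Q (f ∘ suc)

sumOff : ∀ {k} → Subset k → (Fin k → ℕ) → ℕ
sumOff []          f = 0
sumOff (true ∷ Q)  f = sumOff Q (f ∘ suc)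
sumOff (false ∷ Q) f = f zero + sumOff Q (f ∘ suc)

insert : ∀ {k} → Subset k → Fin k → Subset k
insert Q j = Q [ j ]≔ true

module _ where
  private
    swap-* : ∀ x y z → x * (y * z) ≡ y * (x * z)
    swap-* = solve-∀
    swap-+ : ∀ x y z → x + (y + z) ≡ y + (x + z)
    swap-+ = solve-∀
    swap-omit : ∀ x y z w → x * (y * z + w) + y * w ≡ y * (x * z + w) + x * w
    swap-omit = solve-∀

  prodOff-insert : ∀ {k} (Q : Subset k) j f → j ∉ Q → prodOff Q f ≡ f j * prodOff (insert Q j) f
  prodOff-insert (true ∷ Q)  zero    f j∉ = contradiction here j∉
  prodOff-insert (false ∷ Q) zero    f j∉ = refl
  prodOff-insert (true ∷ Q)  (suc j) f j∉ = prodOff-insert Q j _ (j∉ ∘ there)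
  prodOff-insert (false ∷ Q) (suc j) f j∉
    rewrite prodOff-insert Q j (f ∘ suc) (j∉ ∘ there) = swap-* (f zero) (f (suc j)) _

  sumOff-insert : ∀ {k} (Q : Subset k) j f → j ∉ Q → sumOff Q f ≡ f j + sumOff (insert Q j) f
  sumOff-insert (true ∷ Q)  zero    f j∉ = contradiction here j∉
  sumOff-insert (false ∷ Q) zero    f j∉ = refl
  sumOff-insert (true ∷ Q)  (suc j) f j∉ = sumOff-insert Q j _ (j∉ ∘ there)
  sumOff-insert (false ∷ Q) (suc j) f j∉
    rewrite sumOff-insert Q j (f ∘ suc) (j∉ ∘ there) = swap-+ (f zero) (f (suc j)) _

  -- Terms omitting an index other than `j` keep the factor `f j`; the one omitting `j` is the
  -- product over the rest. The point is that the value is affine in `f j`.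
  omitOff-insert : ∀ {k} (Q : Subset k) j f → j ∉ Q →
    omitOff Q f ≡ f j * omitOff (insert Q j) f + prodOff (insert Q j) f
  omitOff-insert (true ∷ Q)  zero    f j∉ = contradiction here j∉
  omitOff-insert (false ∷ Q) zero    f j∉ = refl
  omitOff-insert (true ∷ Q)  (suc j) f j∉ = omitOff-insert Q j _ (j∉ ∘ there)
  omitOff-insert (false ∷ Q) (suc j) f j∉
    rewrite omitOff-insert Q j (f ∘ suc) (j∉ ∘ there) | prodOff-insert Q j (f ∘ suc) (j∉ ∘ there) =
    swap-omit (f zero) (f (suc j)) (omitOff (insert Q j) (f ∘ suc)) (prodOff (insert Q j) (f ∘ suc))

prodOff-cong : ∀ {k} (Q : Subset k) {f g : Fin k → ℕ} → (∀ i → i ∉ Q → f i ≡ g i) → prodOff Q f ≡ prodOff Q g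
prodOff-cong []          eq = refl
prodOff-cong (true ∷ Q)  eq = prodOff-cong Q (λ i i∉ → eq (suc i) λ { (there p) → i∉ p })
prodOff-cong (false ∷ Q) eq = cong₂ _*_ (eq zero λ ()) (prodOff-cong Q (λ i i∉ → eq (suc i) λ { (there p) → i∉ p }))

omitOff-cong : ∀ {k} (Q : Subset k) {f g : Fin k → ℕ} → (∀ i → i ∉ Q → f i ≡ g i) → omitOff Q f ≡ omitOff Q g
omitOff-cong []          eq = refl
omitOff-cong (true ∷ Q)  eq = omitOff-cong Q (λ i i∉ → eq (suc i) λ { (there p) → i∉ p })
omitOff-cong (false ∷ Q) eq = cong₂ _+_
  (cong₂ _*_ (eq zero λ ()) (omitOff-cong Q (λ i i∉ → eq (suc i) λ { (there p) → i∉ p })))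
  (prodOff-cong Q (λ i i∉ → eq (suc i) λ { (there p) → i∉ p }))

sumOff-cong : ∀ {k} (Q : Subset k) {f g : Fin k → ℕ} → (∀ i → i ∉ Q → f i ≡ g i) → sumOff Q f ≡ sumOff Q g
sumOff-cong []          eq = refl
sumOff-cong (true ∷ Q)  eq = sumOff-cong Q (λ i i∉ → eq (suc i) λ { (there p) → i∉ p })
sumOff-cong (false ∷ Q) eq = cong₂ _+_ (eq zero λ ()) (sumOff-cong Q (λ i i∉ → eq (suc i) λ { (there p) → i∉ p }))

prodOff-const : ∀ {k} (Q : Subset k) c → prodOff Q (λ _ → c) ≡ c ^ ∣ ∁ Q ∣
prodOff-const []          c = refl
prodOff-const (true ∷ Q)  c = prodOff-const Q c
prodOff-const (false ∷ Q) c = cong (c *_) (prodOff-const Q c)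

-- With `a` free indices the omitted sum is `a` times the power of `c` with exponent `a - 1`. The
-- factor `c` on the left avoids that exponent, which would be negative for `a = 0`.
omitOff-const : ∀ {k} (Q : Subset k) c → c * omitOff Q (λ _ → c) ≡ ∣ ∁ Q ∣ * c ^ ∣ ∁ Q ∣
omitOff-const []          c = *-zeroʳ c
omitOff-const (true ∷ Q)  c = omitOff-const Q c
omitOff-const (false ∷ Q) c = begin
  c * (c * o + p)             ≡⟨ *-distribˡ-+ c (c * o) p ⟩
  c * (c * o) + c * p         ≡⟨ cong₂ (λ x y → c * x + c * y) (omitOff-const Q c) (prodOff-const Q c) ⟩
  c * (a * c ^ a) + c * c ^ a ≡⟨ regroup c a (c ^ a) ⟩
  suc a * (c * c ^ a)         ∎
  where
  open ≡-Reasoning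
  o = omitOff Q (λ _ → c)
  p = prodOff Q (λ _ → c)
  a = ∣ ∁ Q ∣
  regroup : ∀ c a x → c * (a * x) + c * x ≡ suc a * (c * x)
  regroup = solve-∀

module _ {k : ℕ} (Q : Subset k) {f : Fin k → ℕ} {c : ℕ} (f≡c : ∀ i → i ∉ Q → f i ≡ c) where

  prodOff-uniform : prodOff Q f ≡ c ^ ∣ ∁ Q ∣
  prodOff-uniform = trans (prodOff-cong Q f≡c) (prodOff-const Q c)

  omitOff-uniform : c * omitOff Q f ≡ ∣ ∁ Q ∣ * c ^ ∣ ∁ Q ∣
  omitOff-uniform = trans (cong (c *_) (omitOff-cong Q f≡c)) (omitOff-const Q c)

prodOff-full : ∀ {k} (Q : Subset k) f → (∀ i → i ∈ Q) → prodOff Q f ≡ 1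
prodOff-full []          f full = refl
prodOff-full (true ∷ Q)  f full = prodOff-full Q _ λ i → drop-there (full (suc i))
prodOff-full (false ∷ Q) f full with full zero
... | ()

omitOff-full : ∀ {k} (Q : Subset k) f → (∀ i → i ∈ Q) → omitOff Q f ≡ 0
omitOff-full []          f full = refl
omitOff-full (true ∷ Q)  f full = omitOff-full Q _ λ i → drop-there (full (suc i))
omitOff-full (false ∷ Q) f full with full zero
... | ()

x∈p⇒∣p∣≢0 : ∀ {k} {p : Subset k} {x} → x ∈ p → ∣ p ∣ ≢ 0
x∈p⇒∣p∣≢0 {p = true ∷ p}  here       ()
x∈p⇒∣p∣≢0 {p = true ∷ p}  (there x∈) ()
x∈p⇒∣p∣≢0 {p = false ∷ p} (there x∈) = x∈p⇒∣p∣≢0 x∈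

module Decrement {k : ℕ} (Q : Subset k) (f g : Fin k → ℕ) {j : Fin k} (j∉Q : j ∉ Q)
    (f-at : f j ≡ suc (g j)) (g-off : ∀ {i} → i ≢ j → g i ≡ f i) where

  private
    g-off-insert : ∀ i → i ∉ insert Q j → g i ≡ f i
    g-off-insert i i∉ = g-off λ { refl → i∉ (Vec.[]≔-updates Q j) }

    regroup : ∀ c o p → suc c * o + p ≡ o + (c * o + p)
    regroup = solve-∀

  prodOff-decrement : prodOff Q f ≡ prodOff (insert Q j) f + prodOff Q g
  prodOff-decrement
    rewrite prodOff-insert Q j f j∉Q | prodOff-insert Q j g j∉Q
          | prodOff-cong (insert Q j) g-off-insert | f-at = refl

  -- Both `omitOff Q f` and `omitOff Q g` are affine in the value at `j` with the same coefficients.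
  -- Raising that value by one adds the slope, which is the weight with `j` moved into `Q`.
  omitOff-decrement : omitOff Q f ≡ omitOff (insert Q j) f + omitOff Q g
  omitOff-decrement
    rewrite omitOff-insert Q j f j∉Q | omitOff-insert Q j g j∉Q
          | prodOff-cong (insert Q j) g-off-insert | omitOff-cong (insert Q j) g-off-insert | f-at =
    regroup (g j) (omitOff (insert Q j) f) (prodOff (insert Q j) f)

  sumOff-decrement : sumOff Q f ≡ suc (sumOff Q g)
  sumOff-decrement
    rewrite sumOff-insert Q j f j∉Q | sumOff-insert Q j g j∉Q
          | sumOff-cong (insert Q j) g-off-insert | f-at = refl

  -- The removed summand `f j` is a successor: in the application the degree is positive because an
  -- edge meets `j`.
  sumOff-insert-< : sumOff (insert Q j) f < sumOff Q f
  sumOff-insert-< rewrite sumOff-insert Q j f j∉Q | f-at = s≤s (m≤n+m _ (g j))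

-- Degrees in a set of edges

edge : ∀ {m n} → EdgeSet m n → Fin m → Fin n → Bool
edge E i j = lookup (lookup E i) j

setEdge : ∀ {m n} → EdgeSet m n → Fin m → Fin n → Bool → EdgeSet m n
setEdge E i j b = E [ i ]≔ (lookup E i [ j ]≔ b)

rowDeg : ∀ {m n} → EdgeSet m n → Fin m → ℕ
rowDeg E i = ∣ tabulate (λ j → edge E i j) ∣

colDeg : ∀ {m n} → EdgeSet m n → Fin n → ℕ
colDeg E j = ∣ tabulate (λ i → edge E i j) ∣

module _ {m n : ℕ} (E : EdgeSet m n) (i : Fin m) (j : Fin n) where

  edge-set-at : ∀ b → edge (setEdge E i j b) i j ≡ b
  edge-set-at b = trans (cong (λ r → lookup r j) (Vec.lookup∘update i E _)) (Vec.lookup∘update j (lookup E i) b)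

  edge-set-row : ∀ b {i′} j′ → i′ ≢ i → edge (setEdge E i j b) i′ j′ ≡ edge E i′ j′
  edge-set-row b j′ i′≢i = cong (λ r → lookup r j′) (Vec.lookup∘update′ i′≢i E _)

  edge-set-col : ∀ b i′ {j′} → j′ ≢ j → edge (setEdge E i j b) i′ j′ ≡ edge E i′ j′
  edge-set-col b i′ j′≢j with i′ Fin.≟ i
  ... | no i′≢i  = edge-set-row b _ i′≢i
  ... | yes refl = trans (cong (λ r → lookup r _) (Vec.lookup∘update i E _)) (Vec.lookup∘update′ j′≢j (lookup E i) b)

  edge-set-off : ∀ b i′ j′ → edge (setEdge E i j b) i′ j′ ≡ edge E i′ j′ ⊎ (i′ ≡ i × j′ ≡ j)
  edge-set-off b i′ j′ with i′ Fin.≟ i | j′ Fin.≟ j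
  ... | no i′≢i | _       = inj₁ (edge-set-row b j′ i′≢i)
  ... | yes _   | no j′≢j = inj₁ (edge-set-col b i′ j′≢j)
  ... | yes p   | yes q   = inj₂ (p , q)

  add : EdgeSet m n
  add = setEdge E i j true

  del : EdgeSet m n
  del = setEdge E i j false

  add-⊇ : E ⊆ₑ add
  add-⊇ i′ j′ e with edge-set-off true i′ j′
  ... | inj₁ eq            = trans eq e
  ... | inj₂ (refl , refl) = edge-set-at true

  add-new : ∀ i′ j′ → HasEdge add i′ j′ → HasEdge E i′ j′ ⊎ (i′ ≡ i × j′ ≡ j)
  add-new i′ j′ e with edge-set-off true i′ j′
  ... | inj₁ eq = inj₁ (trans (sym eq) e)
  ... | inj₂ p  = inj₂ p

  add-⊆ : ∀ {F} → E ⊆ₑ F → HasEdge F i j → add ⊆ₑ F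
  add-⊆ E⊆F e i′ j′ e′ with add-new i′ j′ e′
  ... | inj₁ old           = E⊆F i′ j′ old
  ... | inj₂ (refl , refl) = e

  del-at : ¬ HasEdge del i j
  del-at e with trans (sym (edge-set-at false)) e
  ... | ()

  del-⊆ : del ⊆ₑ E
  del-⊆ i′ j′ e with edge-set-off false i′ j′
  ... | inj₁ eq            = trans (sym eq) e
  ... | inj₂ (refl , refl) = contradiction e del-at

  del-⊇ : ∀ {F} → F ⊆ₑ E → ¬ HasEdge F i j → F ⊆ₑ del
  del-⊇ F⊆E ¬e i′ j′ e with edge-set-off false i′ j′
  ... | inj₁ eq            = trans eq (F⊆E i′ j′ e)
  ... | inj₂ (refl , refl) = contradiction e ¬e

count-flip : ∀ {k} (f g : Fin k → Bool) j → f j ≡ true → g j ≡ false → (∀ {i} → i ≢ j → g i ≡ f i) →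
  ∣ tabulate f ∣ ≡ suc ∣ tabulate g ∣
count-flip f g zero fj gj off
  rewrite fj | gj | Vec.tabulate-cong {f = g ∘ suc} {f ∘ suc} (λ i → off {suc i} λ ()) = refl
count-flip f g (suc j) fj gj off
  rewrite off {zero} (λ ()) | count-flip (f ∘ suc) (g ∘ suc) j fj gj (λ i≢j → off (i≢j ∘ Fin.suc-injective))
  with f zero
... | true  = refl
... | false = refl

module _ {m n : ℕ} (E : EdgeSet m n) {i : Fin m} {j : Fin n} (e : HasEdge E i j) where

  rowDeg-del : rowDeg E i ≡ suc (rowDeg (del E i j) i)
  rowDeg-del = count-flip _ _ j e (edge-set-at E i j false) (edge-set-col E i j false i)

  colDeg-del : colDeg E j ≡ suc (colDeg (del E i j) j)
  colDeg-del = count-flip _ _ i e (edge-set-at E i j false) (edge-set-row E i j false j)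

module _ {m n : ℕ} (E : EdgeSet m n) (i : Fin m) (j : Fin n) where

  rowDeg-del-off : ∀ {i′} → i′ ≢ i → rowDeg (del E i j) i′ ≡ rowDeg E i′
  rowDeg-del-off i′≢i = cong ∣_∣ (Vec.tabulate-cong (λ j′ → edge-set-row E i j false j′ i′≢i))

  colDeg-del-off : ∀ {j′} → j′ ≢ j → colDeg (del E i j) j′ ≡ colDeg E j′
  colDeg-del-off j′≢j = cong ∣_∣ (Vec.tabulate-cong (λ i′ → edge-set-col E i j false i′ j′≢j))

  rowDeg-del-∉ : ∀ {VX : Subset m} → i ∈ VX → ∀ i′ → i′ ∉ VX → rowDeg (del E i j) i′ ≡ rowDeg E i′
  rowDeg-del-∉ i∈ i′ i′∉ = rowDeg-del-off λ { refl → i′∉ i∈ }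

  colDeg-del-∉ : ∀ {VY : Subset n} → j ∈ VY → ∀ j′ → j′ ∉ VY → colDeg (del E i j) j′ ≡ colDeg E j′
  colDeg-del-∉ j∈ j′ j′∉ = colDeg-del-off λ { refl → j′∉ j∈ }

edgeSet-ext : ∀ {m n} {E F : EdgeSet m n} → E ⊆ₑ F → F ⊆ₑ E → E ≡ F
edgeSet-ext {E = E} {F} E⊆F F⊆E = Pointwise-≡⇒≡ (ext λ i → Pointwise-≡⇒≡ (ext λ j → same i j))
  where
  same : ∀ i j → edge E i j ≡ edge F i j
  same i j with edge E i j in p | edge F i j in q
  ... | true  | true  = refl
  ... | false | false = refl
  ... | true  | false = trans (sym (E⊆F i j p)) q
  ... | false | true  = trans (sym p) (F⊆E i j q)

-- Growing a tree by a leaf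

_≟ᵥ_ : ∀ {m n} → DecidableEquality (Vertex m n)
_≟ᵥ_ = Sum.≡-dec Fin._≟_ Fin._≟_

Adj-mono : ∀ {m n} {E F : EdgeSet m n} → E ⊆ₑ F → ∀ {x y} → Adj E x y → Adj F x y
Adj-mono E⊆F {inj₁ i} {inj₂ j} e = E⊆F i j e
Adj-mono E⊆F {inj₂ j} {inj₁ i} e = E⊆F i j e

Adj-sym : ∀ {m n} {E : EdgeSet m n} {x y} → Adj E x y → Adj E y x
Adj-sym {x = inj₁ i} {inj₂ j} e = e
Adj-sym {x = inj₂ j} {inj₁ i} e = e

Adj-InV : ∀ {m n} {VX : Subset m} {VY : Subset n} {E} → IsSubgraph VX VY E →
  ∀ {x y} → Adj E x y → InV VX VY y
Adj-InV sub {inj₁ i} {inj₂ j} e = proj₂ (sub i j e)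
Adj-InV sub {inj₂ j} {inj₁ i} e = proj₁ (sub i j e)

Adj-add : ∀ {m n} (E : EdgeSet m n) i j {x y} → Adj (add E i j) x y →
  Adj E x y ⊎ (x ≡ inj₁ i × y ≡ inj₂ j) ⊎ (x ≡ inj₂ j × y ≡ inj₁ i)
Adj-add E i j {inj₁ i′} {inj₂ j′} e with add-new E i j i′ j′ e
... | inj₁ old           = inj₁ old
... | inj₂ (refl , refl) = inj₂ (inj₁ (refl , refl))
Adj-add E i j {inj₂ j′} {inj₁ i′} e with add-new E i j i′ j′ e
... | inj₁ old           = inj₁ old
... | inj₂ (refl , refl) = inj₂ (inj₂ (refl , refl))

∈-insert⁺ : ∀ {k} {Q : Subset k} {j x} → x ∈ Q → x ∈ insert Q j
∈-insert⁺ {Q = Q} {j} {x} x∈ with x Fin.≟ j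
... | yes refl = Vec.[]≔-updates Q j
... | no x≢j   = Vec.[]≔-minimal Q x j x≢j x∈

∈-insert⁻ : ∀ {k} (Q : Subset k) {j x} → x ∈ insert Q j → x ∈ Q ⊎ x ≡ j
∈-insert⁻ Q {j} {x} x∈ with x Fin.≟ j
... | yes x≡j = inj₂ x≡j
... | no x≢j  = inj₁ (Vec.lookup⇒[]= x Q (trans (sym (Vec.lookup∘update′ x≢j Q true)) (Vec.[]=⇒lookup x∈)))

-- Connections are routed through `u`, to which `w` is adjacent. Edges of `E` stay inside the old
-- vertex set, so `w` is isolated in `E` and `addLeaf-acyclic` applies. Keeping `u` and `w` abstract
-- serves leaves on either side of the bipartition.
addLeaf-tree : ∀ {m n} {VX VX′ : Subset m} {VY VY′ : Subset n} {E E′ : EdgeSet m n} {u w} →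
  IsTree VX VY E → IsSubgraph VX′ VY′ E′ →
  InV VX VY u → ¬ InV VX VY w →
  (∀ v → InV VX VY v → InV VX′ VY′ v) → (∀ v → InV VX′ VY′ v → InV VX VY v ⊎ v ≡ w) →
  E ⊆ₑ E′ → Adj E′ u w →
  (∀ {x y} → Adj E′ x y → Adj E x y ⊎ (x ≡ u × y ≡ w) ⊎ (x ≡ w × y ≡ u)) →
  IsTree VX′ VY′ E′
addLeaf-tree {VX = VX} {VX′} {VY} {VY′} {E} {E′} {u} {w}
    (sub , (v₀ , v₀∈) , conn , acyc) sub′ u∈ w∉ V⊆V′ V′⊆ E⊆E′ uw new =
  sub′ , (v₀ , V⊆V′ v₀ v₀∈) , conn′ ,
  addLeaf-acyclic _≟ᵥ_ (λ {x} e → w∉ (Adj-InV sub {x} e)) (λ {x} e → w∉ (Adj-InV sub {x} (Adj-sym {x = w} {x} e)))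
    (λ {x} {y} → new {x} {y}) acyc
  where
  toU : ∀ x → InV VX′ VY′ x → Reachable E′ x u
  toU x x∈′ with V′⊆ x x∈′
  ... | inj₁ x∈   = Star.map (λ {a} {b} → Adj-mono E⊆E′ {a} {b}) (conn x u x∈ u∈)
  ... | inj₂ refl = Adj-sym {x = u} {w} uw ◅ ε
  fromU : ∀ x → InV VX′ VY′ x → Reachable E′ u x
  fromU x x∈′ with V′⊆ x x∈′
  ... | inj₁ x∈   = Star.map (λ {a} {b} → Adj-mono E⊆E′ {a} {b}) (conn u x u∈ x∈)
  ... | inj₂ refl = uw ◅ ε
  conn′ : ∀ x y → InV VX′ VY′ x → InV VX′ VY′ y → Reachable E′ x y
  conn′ x y x∈ y∈ = toU x x∈ ◅◅ fromU y y∈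

module _ {m n : ℕ} {VX : Subset m} {VY : Subset n} {E : EdgeSet m n} (tree : IsTree VX VY E) {i : Fin m} {j : Fin n} where

  addLeafY-tree : i ∈ VX → j ∉ VY → IsTree VX (insert VY j) (add E i j)
  addLeafY-tree i∈ j∉ = addLeaf-tree {u = inj₁ i} {inj₂ j} tree sub′ i∈ j∉ grow shrink
    (add-⊇ E i j) (edge-set-at E i j true) (λ {x} {y} → Adj-add E i j {x} {y})
    where
    sub′ : IsSubgraph VX (insert VY j) (add E i j)
    sub′ i′ j′ e with add-new E i j i′ j′ e
    ... | inj₁ old = let p , q = proj₁ tree i′ j′ old in p , ∈-insert⁺ q
    ... | inj₂ (refl , refl) = i∈ , Vec.[]≔-updates VY j
    grow : ∀ v → InV VX VY v → InV VX (insert VY j) v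
    grow (inj₁ _) p = p
    grow (inj₂ _) p = ∈-insert⁺ p
    shrink : ∀ v → InV VX (insert VY j) v → InV VX VY v ⊎ v ≡ inj₂ j
    shrink (inj₁ _) p = inj₁ p
    shrink (inj₂ _) p = Sum.map₂ (cong inj₂) (∈-insert⁻ VY p)

  addLeafX-tree : i ∉ VX → j ∈ VY → IsTree (insert VX i) VY (add E i j)
  addLeafX-tree i∉ j∈ = addLeaf-tree {u = inj₂ j} {inj₁ i} tree sub′ j∈ i∉ grow shrink
    -- The leaf is now on the X side, so the two orientations of the new edge change places.
    (add-⊇ E i j) (edge-set-at E i j true) (λ {x} {y} → Sum.map₂ Sum.swap ∘ Adj-add E i j {x} {y})
    where
    sub′ : IsSubgraph (insert VX i) VY (add E i j)
    sub′ i′ j′ e with add-new E i j i′ j′ e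
    ... | inj₁ old = let p , q = proj₁ tree i′ j′ old in ∈-insert⁺ p , q
    ... | inj₂ (refl , refl) = Vec.[]≔-updates VX i , j∈
    grow : ∀ v → InV VX VY v → InV (insert VX i) VY v
    grow (inj₁ _) p = ∈-insert⁺ p
    grow (inj₂ _) p = p
    shrink : ∀ v → InV (insert VX i) VY v → InV VX VY v ⊎ v ≡ inj₁ i
    shrink (inj₁ _) p = Sum.map₂ (cong inj₁) (∈-insert⁻ VX p)
    shrink (inj₂ _) p = inj₁ p

-- An edge of `S` outside `E` joins two vertices that `E` already connects, and so closes a cycle in
-- `S`.
spanningTree-maximal : ∀ {m n} {E S : EdgeSet m n} → (∀ u v → Reachable E u v) → Acyclic S →
  E ⊆ₑ S → S ≡ E
spanningTree-maximal {E = E} {S} conn acyc E⊆S = edgeSet-ext S⊆E E⊆S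
  where
  S⊆E : S ⊆ₑ E
  S⊆E i j s with edge E i j Bool.≟ true
  ... | yes e = e
  ... | no ¬e = ⊥-elim (acyc (closingEdge-cycle _≟ᵥ_ {R = Adj E} {Adj S} {inj₁ i} {inj₂ j}
                  (λ ()) (conn _ _) ¬e (λ {x} {y} → Adj-mono E⊆S {x} {y}) s))

-- The witness is the first step of the walk that leaves the vertex set.
crossing : ∀ {m n} {E : EdgeSet m n} (VX : Subset m) (VY : Subset n) {u v} → Reachable E u v →
  InV VX VY u → ¬ InV VX VY v →
  ∃ λ x → ∃ λ y → InV VX VY x × ¬ InV VX VY y × Adj E x y
crossing VX VY ε u∈ v∉ = contradiction u∈ v∉
crossing VX VY {u} (_◅_ {j = w} e r) u∈ v∉ with inV? w
  where
  inV? : ∀ x → Dec (InV VX VY x)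
  inV? (inj₁ i) = i ∈? VX
  inV? (inj₂ j) = j ∈? VY
... | yes w∈ = crossing VX VY r w∈ v∉
... | no w∉  = u , w , u∈ , w∉ , e

-- Deletion and contraction

module _ {m n : ℕ} where

  card-⇔ : {P Q : EdgeSet m n → Set} {N : ℕ} → (∀ S → P S → Q S) → (∀ S → Q S → P S) →
    HasCardinality P N → HasCardinality Q N
  card-⇔ f g (L , uniq , mem , len) =
    L , uniq , (λ S → mk⇔ (f S ∘ Equivalence.to (mem S)) (Equivalence.from (mem S) ∘ g S)) , len

  card-⊎ : {P Q R : EdgeSet m n → Set} {M N : ℕ} →
    (∀ S → P S → R S) → (∀ S → Q S → R S) → (∀ S → R S → P S ⊎ Q S) → (∀ S → P S → ¬ Q S) →
    HasCardinality P M → HasCardinality Q N → HasCardinality R (M + N)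
  card-⊎ p q split disj (L , uniq , mem , refl) (L′ , uniq′ , mem′ , refl) =
    L ++ L′ ,
    Unique.++⁺ uniq uniq′ (λ { {S} (a , b) → disj S (Equivalence.to (mem S) a) (Equivalence.to (mem′ S) b) }) ,
    (λ S → mk⇔
      ([ p S ∘ Equivalence.to (mem S) , q S ∘ Equivalence.to (mem′ S) ]′ ∘ List.∈-++⁻ L)
      ([ List.∈-++⁺ˡ ∘ Equivalence.from (mem S) , List.∈-++⁺ʳ L ∘ Equivalence.from (mem′ S) ]′ ∘ split S)) ,
    length-++ L

  card-empty : {P : EdgeSet m n → Set} → (∀ S → ¬ P S) → HasCardinality P 0
  card-empty ¬P = [] , [] , (λ S → mk⇔ (λ ()) (⊥-elim ∘ ¬P S)) , refl

  card-singleton : {P : EdgeSet m n → Set} (S₀ : EdgeSet m n) → P S₀ → (∀ S → P S → S ≡ S₀) → HasCardinality P 1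
  card-singleton S₀ p unique =
    [ S₀ ] , [] ∷ [] , (λ S → mk⇔ (λ { (here refl) → p }) (here ∘ unique S)) , refl

  -- Contracting an edge is modelled by enlarging the lower bound `E`, deleting one by shrinking the
  -- upper bound `A`; the ambient vertex set never changes.
  Between : EdgeSet m n → EdgeSet m n → EdgeSet m n → Set
  Between E A S = IsSpanningTree S × E ⊆ₑ S × S ⊆ₑ A

  between-split : ∀ E A {i j N₁ N₂} →
    HasCardinality (Between (add E i j) A) N₁ → HasCardinality (Between E (del A i j)) N₂ →
    HasCardinality (Between E A) (N₁ + N₂)
  between-split E A {i} {j} = card-⊎
    (λ { S (st , l , u) → st , (λ i′ j′ → l i′ j′ ∘ add-⊇ E i j i′ j′) , u })
    (λ { S (st , l , u) → st , l , λ i′ j′ → del-⊆ A i j i′ j′ ∘ u i′ j′ })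
    split
    (λ { S (_ , l , _) (_ , _ , u) → del-at A i j (u i j (l i j (edge-set-at E i j true))) })
    where
    split : ∀ S → Between E A S → Between (add E i j) A S ⊎ Between E (del A i j) S
    split S (st , l , u) with edge S i j Bool.≟ true
    ... | yes e = inj₁ (st , add-⊆ E i j {S} l e , u)
    ... | no ¬e = inj₂ (st , l , del-⊇ A i j {S} u ¬e)

  -- The subtracted product stands on the side of `N`, so the equation stays within the natural
  -- numbers and two instances can be added.
  Solution : Subset m → Subset n → EdgeSet m n → EdgeSet m n → Set
  Solution VX VY E A = Σ ℕ λ N → HasCardinality (Between E A) N ×
    N + omitOff VX (rowDeg A) * omitOff VY (colDeg A) ≡ prodOff VX (rowDeg A) * prodOff VY (colDeg A)

  -- Termination measure: the total degree of the vertices outside the tree, which drops both when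
  -- an edge leaving the tree is contracted and when it is deleted.
  weight : Subset m → Subset n → EdgeSet m n → ℕ
  weight VX VY A = sumOff VX (rowDeg A) + sumOff VY (colDeg A)

  module _ (VX : Subset m) (VY : Subset n) (E A : EdgeSet m n) {i : Fin m} {j : Fin n} (e : HasEdge A i j) where
    private
      add-equationsʳ : ∀ N₁ N₂ u′ v₁′ v₂′ u v₁ v₂ → N₁ + u′ * v₁′ ≡ u * v₁ → N₂ + u′ * v₂′ ≡ u * v₂ →
        N₁ + N₂ + u′ * (v₁′ + v₂′) ≡ u * (v₁ + v₂)
      add-equationsʳ N₁ N₂ u′ v₁′ v₂′ u v₁ v₂ p q =
        trans (regroup N₁ N₂ u′ v₁′ v₂′) (trans (cong₂ _+_ p q) (sym (*-distribˡ-+ u v₁ v₂)))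
        where
        regroup : ∀ a b u x y → a + b + u * (x + y) ≡ (a + u * x) + (b + u * y)
        regroup = solve-∀

      add-equationsˡ : ∀ N₁ N₂ u₁′ u₂′ v′ u₁ u₂ v → N₁ + u₁′ * v′ ≡ u₁ * v → N₂ + u₂′ * v′ ≡ u₂ * v →
        N₁ + N₂ + (u₁′ + u₂′) * v′ ≡ (u₁ + u₂) * v
      add-equationsˡ N₁ N₂ u₁′ u₂′ v′ u₁ u₂ v p q =
        trans (regroup N₁ N₂ u₁′ u₂′ v′) (trans (cong₂ _+_ p q) (sym (*-distribʳ-+ v u₁ u₂)))
        where
        regroup : ∀ a b x y v → a + b + (x + y) * v ≡ (a + x * v) + (b + y * v)
        regroup = solve-∀

    -- Since `i` lies in the tree, deleting the edge changes no free row degree, so both subproblems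
    -- share their row factors. The column factors split by `Decrement`, and the two equations add
    -- up by distributivity.
    stepY : i ∈ VX → j ∉ VY →
      Solution VX (insert VY j) (add E i j) A → Solution VX VY E (del A i j) → Solution VX VY E A
    stepY i∈ j∉ (N₁ , card₁ , eq₁) (N₂ , card₂ , eq₂)
      rewrite prodOff-cong VX (rowDeg-del-∉ A i j i∈) | omitOff-cong VX (rowDeg-del-∉ A i j i∈) =
      N₁ + N₂ , between-split E A card₁ card₂ , eq
      where
      open Decrement VY (colDeg A) (colDeg (del A i j)) j∉ (colDeg-del A e) (colDeg-del-off A i j)
      eq : N₁ + N₂ + omitOff VX (rowDeg A) * omitOff VY (colDeg A) ≡ prodOff VX (rowDeg A) * prodOff VY (colDeg A)
      eq rewrite prodOff-decrement | omitOff-decrement =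
        add-equationsʳ N₁ N₂ (omitOff VX (rowDeg A)) _ _ (prodOff VX (rowDeg A)) _ _ eq₁ eq₂

    stepX : i ∉ VX → j ∈ VY →
      Solution (insert VX i) VY (add E i j) A → Solution VX VY E (del A i j) → Solution VX VY E A
    stepX i∉ j∈ (N₁ , card₁ , eq₁) (N₂ , card₂ , eq₂)
      rewrite prodOff-cong VY (colDeg-del-∉ A i j j∈) | omitOff-cong VY (colDeg-del-∉ A i j j∈) =
      N₁ + N₂ , between-split E A card₁ card₂ , eq
      where
      open Decrement VX (rowDeg A) (rowDeg (del A i j)) i∉ (rowDeg-del A e) (rowDeg-del-off A i j)
      eq : N₁ + N₂ + omitOff VX (rowDeg A) * omitOff VY (colDeg A) ≡ prodOff VX (rowDeg A) * prodOff VY (colDeg A)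
      eq rewrite prodOff-decrement | omitOff-decrement =
        add-equationsˡ N₁ N₂ (omitOff (insert VX i) (rowDeg A)) (omitOff VX (rowDeg (del A i j))) (omitOff VY (colDeg A))
          (prodOff (insert VX i) (rowDeg A)) (prodOff VX (rowDeg (del A i j))) (prodOff VY (colDeg A)) eq₁ eq₂

  module _ (VX : Subset m) (VY : Subset n) (A : EdgeSet m n) {i : Fin m} {j : Fin n} (e : HasEdge A i j) where

    weight-addY : j ∉ VY → weight VX (insert VY j) A < weight VX VY A
    weight-addY j∉ = +-monoʳ-< (sumOff VX (rowDeg A)) sumOff-insert-<
      where open Decrement VY (colDeg A) (colDeg (del A i j)) j∉ (colDeg-del A e) (colDeg-del-off A i j)

    weight-addX : i ∉ VX → weight (insert VX i) VY A < weight VX VY A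
    weight-addX i∉ = +-monoˡ-< (sumOff VY (colDeg A)) sumOff-insert-<
      where open Decrement VX (rowDeg A) (rowDeg (del A i j)) i∉ (rowDeg-del A e) (rowDeg-del-off A i j)

    weight-delY : i ∈ VX → j ∉ VY → weight VX VY (del A i j) < weight VX VY A
    weight-delY i∈ j∉ rewrite sumOff-cong VX (rowDeg-del-∉ A i j i∈) =
      +-monoʳ-< (sumOff VX (rowDeg A)) (≤-reflexive (sym sumOff-decrement))
      where open Decrement VY (colDeg A) (colDeg (del A i j)) j∉ (colDeg-del A e) (colDeg-del-off A i j)

    weight-delX : i ∉ VX → j ∈ VY → weight VX VY (del A i j) < weight VX VY A
    weight-delX i∉ j∈ rewrite sumOff-cong VY (colDeg-del-∉ A i j j∈) =
      +-monoˡ-< (sumOff VY (colDeg A)) (≤-reflexive (sym sumOff-decrement))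
      where open Decrement VX (rowDeg A) (rowDeg (del A i j)) i∉ (rowDeg-del A e) (rowDeg-del-off A i j)

-- Trees that no allowed edge leaves

module _ {m n : ℕ} (VX : Subset m) (VY : Subset n) (E A : EdgeSet m n) (tree : IsTree VX VY E) (E⊆A : E ⊆ₑ A)
    (free : ∀ i j → i ∉ VX → j ∉ VY → HasEdge A i j)
    (noY : ∀ i j → i ∈ VX → j ∉ VY → ¬ HasEdge A i j)
    (noX : ∀ i j → i ∉ VX → j ∈ VY → ¬ HasEdge A i j) where

  private
    a = ∣ ∁ VX ∣
    b = ∣ ∁ VY ∣

    -- The row of a free vertex is the indicator of the free columns: `noX` rules out the columns of
    -- the tree, and `free` supplies all others.
    rowDeg-free : ∀ i → i ∉ VX → rowDeg A i ≡ b
    rowDeg-free i i∉ = cong ∣_∣ (trans (Vec.tabulate-cong same) (Vec.tabulate∘lookup (∁ VY)))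
      where
      same : ∀ j → edge A i j ≡ lookup (∁ VY) j
      same j rewrite Vec.lookup-map j not VY with lookup VY j in eq
      ... | true  = Bool.¬-not (noX i j i∉ (Vec.lookup⇒[]= j VY eq))
      ... | false = free i j i∉ λ j∈ → Bool.not-¬ eq (Vec.[]=⇒lookup j∈)

    colDeg-free : ∀ j → j ∉ VY → colDeg A j ≡ a
    colDeg-free j j∉ = cong ∣_∣ (trans (Vec.tabulate-cong same) (Vec.tabulate∘lookup (∁ VX)))
      where
      same : ∀ i → edge A i j ≡ lookup (∁ VX) i
      same i rewrite Vec.lookup-map i not VX with lookup VX i in eq
      ... | true  = Bool.¬-not (noY i j (Vec.lookup⇒[]= i VX eq) j∉)
      ... | false = free i j (λ i∈ → Bool.not-¬ eq (Vec.[]=⇒lookup i∈)) j∉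

    -- If both numbers are positive, the two equations are multiplied and the factor `b * a` is
    -- cancelled. If exactly one is zero, one omitted sum vanishes, and the right side contains zero
    -- to a positive power. For `a = b = 0` the right side is 1, which is the spanning case treated
    -- separately.
    cancel : ∀ a b u′ v′ → a ≢ 0 ⊎ b ≢ 0 → b * u′ ≡ a * b ^ a → a * v′ ≡ b * a ^ b → u′ * v′ ≡ b ^ a * a ^ b
    cancel zero    zero    u′ v′ (inj₁ p) _ _ = contradiction refl p
    cancel zero    zero    u′ v′ (inj₂ p) _ _ = contradiction refl p
    cancel zero    (suc b) u′ v′ _ p q rewrite m*n≡0⇒m≡0 u′ (suc b) (trans (*-comm u′ (suc b)) p) = refl
    cancel (suc a) zero    u′ v′ _ p q rewrite m*n≡0⇒m≡0 v′ (suc a) (trans (*-comm v′ (suc a)) q) = *-zeroʳ u′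
    cancel (suc a) (suc b) u′ v′ _ p q = *-cancelˡ-≡ _ _ (suc b * suc a) (begin
      suc b * suc a * (u′ * v′)                                ≡⟨ swap (suc b) (suc a) u′ v′ ⟩
      suc b * u′ * (suc a * v′)                                ≡⟨ cong₂ _*_ p q ⟩
      suc a * suc b ^ suc a * (suc b * suc a ^ suc b)          ≡⟨ swap (suc a) (suc b) (suc b ^ suc a) (suc a ^ suc b) ⟨
      suc a * suc b * (suc b ^ suc a * suc a ^ suc b)          ≡⟨ cong (_* (suc b ^ suc a * suc a ^ suc b)) (*-comm (suc a) (suc b)) ⟩
      suc b * suc a * (suc b ^ suc a * suc a ^ suc b)          ∎)
      where
      open ≡-Reasoning
      swap : ∀ x y z w → x * y * (z * w) ≡ x * z * (y * w)
      swap = solve-∀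

    equation : a ≢ 0 ⊎ b ≢ 0 →
      omitOff VX (rowDeg A) * omitOff VY (colDeg A) ≡ prodOff VX (rowDeg A) * prodOff VY (colDeg A)
    equation nonfull
      rewrite prodOff-uniform VX rowDeg-free | prodOff-uniform VY colDeg-free =
      cancel a b _ _ nonfull (omitOff-uniform VX rowDeg-free) (omitOff-uniform VY colDeg-free)

    -- A walk in `S` from a tree vertex to `w` has to leave the tree along an edge of `A`, and `noX`
    -- and `noY` forbid such edges.
    disconnected : ∀ w → ¬ InV VX VY w → ∀ S → ¬ Between E A S
    disconnected w w∉ S ((conn , _) , _ , S⊆A)
      with (v₀ , v₀∈) ← proj₁ (proj₂ tree) with crossing VX VY (conn v₀ w) v₀∈ w∉
    ... | inj₁ i , inj₂ j , i∈ , j∉ , e = noY i j i∈ j∉ (S⊆A i j e)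
    ... | inj₂ j , inj₁ i , j∈ , i∉ , e = noX i j i∉ j∈ (S⊆A i j e)

  solution-closed : Solution VX VY E A
  solution-closed with Fin.all? (_∈? VX) | Fin.all? (_∈? VY)
  ... | no ¬full | _ =
    let i , i∉ = Fin.¬∀⟶∃¬ m _ (_∈? VX) ¬full in
    0 , card-empty (disconnected (inj₁ i) i∉) , equation (inj₁ (x∈p⇒∣p∣≢0 (x∉p⇒x∈∁p i∉)))
  ... | yes _ | no ¬full =
    let j , j∉ = Fin.¬∀⟶∃¬ n _ (_∈? VY) ¬full in
    0 , card-empty (disconnected (inj₂ j) j∉) , equation (inj₂ (x∈p⇒∣p∣≢0 (x∉p⇒x∈∁p j∉)))
  -- The tree spans, so `E` is the only tree counted. Both products are empty, hence 1, and the
  -- omitted sum over rows is 0, which leaves 1 + 0 = 1.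
  ... | yes fullX | yes fullY
    rewrite prodOff-full VX (rowDeg A) fullX | prodOff-full VY (colDeg A) fullY
          | omitOff-full VX (rowDeg A) fullX =
    let _ , _ , conn , acyc = tree
        spans = λ u v → conn u v (full u) (full v)
    in 1 , card-singleton E ((spans , acyc) , (λ _ _ → id) , E⊆A)
             (λ S ((_ , acycS) , E⊆S , _) → spanningTree-maximal spans acycS E⊆S) , refl
    where
    full : ∀ v → InV VX VY v
    full (inj₁ i) = fullX i
    full (inj₂ j) = fullY j

-- Induction over the edges leaving the tree

-- Strong induction on `weight`, with `k` as a strict bound. Any allowed edge with exactly one end
-- in the tree is split on. The condition on free pairs survives: contraction leaves fewer free
-- pairs, and a deleted edge has an end in the tree.
count-between : ∀ {m n} k (VX : Subset m) (VY : Subset n) (E A : EdgeSet m n) → weight VX VY A < k →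
  IsTree VX VY E → E ⊆ₑ A → (∀ i j → i ∉ VX → j ∉ VY → HasEdge A i j) → Solution VX VY E A
count-between (suc k) VX VY E A (s≤s w≤k) tree@(sub , _) E⊆A free
  with Fin.any? (λ i → Fin.any? (λ j → (i ∈? VX) ×-dec ¬? (j ∈? VY) ×-dec (edge A i j Bool.≟ true)))
     | Fin.any? (λ i → Fin.any? (λ j → ¬? (i ∈? VX) ×-dec (j ∈? VY) ×-dec (edge A i j Bool.≟ true)))
... | yes (i , j , i∈ , j∉ , e) | _ = stepY VX VY E A e i∈ j∉
  (count-between k VX (insert VY j) (add E i j) A (<-≤-trans (weight-addY VX VY A e j∉) w≤k)
    (addLeafY-tree tree i∈ j∉) (add-⊆ E i j {A} E⊆A e) (λ i′ j′ i′∉ j′∉ → free i′ j′ i′∉ (j′∉ ∘ ∈-insert⁺)))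
  -- Deletion keeps `E` below the allowed set: the edge has an end outside the tree, so it is not an
  -- edge of `E`.
  (count-between k VX VY E (del A i j) (<-≤-trans (weight-delY VX VY A e i∈ j∉) w≤k)
    tree (del-⊇ A i j {E} E⊆A (j∉ ∘ proj₂ ∘ sub i j))
    (λ i′ j′ i′∉ j′∉ → trans (edge-set-row A i j false j′ (λ { refl → i′∉ i∈ })) (free i′ j′ i′∉ j′∉)))
... | no _ | yes (i , j , i∉ , j∈ , e) = stepX VX VY E A e i∉ j∈
  (count-between k (insert VX i) VY (add E i j) A (<-≤-trans (weight-addX VX VY A e i∉) w≤k)
    (addLeafX-tree tree i∉ j∈) (add-⊆ E i j {A} E⊆A e) (λ i′ j′ i′∉ j′∉ → free i′ j′ (i′∉ ∘ ∈-insert⁺) j′∉))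
  (count-between k VX VY E (del A i j) (<-≤-trans (weight-delX VX VY A e i∉ j∈) w≤k)
    tree (del-⊇ A i j {E} E⊆A (i∉ ∘ proj₁ ∘ sub i j))
    (λ i′ j′ i′∉ j′∉ → trans (edge-set-col A i j false i′ (λ { refl → j′∉ j∈ })) (free i′ j′ i′∉ j′∉)))
... | no noY | no noX = solution-closed VX VY E A tree E⊆A free
  (λ i j i∈ j∉ e → noY (i , j , i∈ , j∉ , e)) (λ i j i∉ j∈ e → noX (i , j , i∉ , j∈ , e))

-- The complete bipartite graph

complete : ∀ m n → EdgeSet m n
complete m n = replicate m (replicate n true)

complete-edge : ∀ {m n} (i : Fin m) (j : Fin n) → HasEdge (complete m n) i j
complete-edge {n = n} i j = trans (cong (λ r → lookup r j) (Vec.lookup-replicate i (replicate n true))) (Vec.lookup-replicate j true)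

count-true : ∀ {k} (f : Fin k → Bool) → (∀ i → f i ≡ true) → ∣ tabulate f ∣ ≡ k
count-true {zero}  f all = refl
count-true {suc k} f all rewrite all zero = cong suc (count-true (f ∘ suc) (all ∘ suc))

rowDeg-complete : ∀ {m n} (i : Fin m) → rowDeg (complete m n) i ≡ n
rowDeg-complete i = count-true _ (complete-edge i)

colDeg-complete : ∀ {m n} (j : Fin n) → colDeg (complete m n) j ≡ m
colDeg-complete j = count-true _ (λ i → complete-edge i j)

∣p∣+∣∁p∣≡n : ∀ {n} (p : Subset n) → ∣ p ∣ + ∣ ∁ p ∣ ≡ n
∣p∣+∣∁p∣≡n p = trans (cong (∣ p ∣ +_) (∣∁p∣≡n∸∣p∣ p)) (m+[n∸m]≡n (∣p∣≤n p))

-- With m = s + a, n = t + b and P = mᵇnᵃ, the relation between N and the omitted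
-- products cleared of denominators reads N m n + a b P = m n P.
clear-denominators : ∀ {N U U′ V V′} s a t b {m n} → s + a ≡ m → t + b ≡ n →
  N + U′ * V′ ≡ U * V → n * U′ ≡ a * U → m * V′ ≡ b * V →
  N * m * n ≡ ((s * n + t * m) ∸ s * t) * V * U
clear-denominators {N} {U} {U′} {V} {V′} s a t b {m} {n} refl refl eq eqU eqV =
  +-cancelʳ-≡ (a * U * (b * V)) _ _ (begin
  N * m * n + a * U * (b * V)                         ≡⟨ cong₂ (λ x y → N * m * n + x * y) eqU eqV ⟨
  N * m * n + n * U′ * (m * V′)                       ≡⟨ factor N m n U′ V′ ⟩
  (N + U′ * V′) * m * n                               ≡⟨ cong (λ x → x * m * n) eq ⟩
  U * V * m * n                                       ≡⟨ expand s a t b U V ⟩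
  (s * b + t * m) * V * U + a * U * (b * V)           ≡⟨ cong (λ x → x * V * U + a * U * (b * V)) monus ⟨
  ((s * n + t * m) ∸ s * t) * V * U + a * U * (b * V) ∎)
  where
  open ≡-Reasoning
  factor : ∀ N m n x y → N * m * n + n * x * (m * y) ≡ (N + x * y) * m * n
  factor = solve-∀
  expand : ∀ s a t b U V → U * V * (s + a) * (t + b) ≡ (s * b + t * (s + a)) * V * U + a * U * (b * V)
  expand = solve-∀
  split : ∀ s a t b → s * (t + b) + t * (s + a) ≡ s * t + (s * b + t * (s + a))
  split = solve-∀
  -- From `n = t + b`, the term `s * n` already contains `s * t`, so the truncated subtraction is
  -- exact.
  monus : (s * n + t * m) ∸ s * t ≡ s * b + t * m
  monus = trans (cong (_∸ s * t) (split s a t b)) (m+n∸m≡n (s * t) _)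

-- When the tree covers a whole side, one of the exponents in the formula is -1. The identity is
-- therefore multiplied through by `m * n`, and as both numbers are positive it still determines the
-- count.
theorem1p4 : (m n : ℕ) → 1 ≤ m → 1 ≤ n →
    (VX : Subset m) (VY : Subset n) (ET : EdgeSet m n) → IsTree VX VY ET →
    Σ ℕ λ τ → TauIs ET τ ×
    (τ * m * n ≡ ((∣ VX ∣ * n + ∣ VY ∣ * m) ∸ ∣ VX ∣ * ∣ VY ∣) * m ^ (n ∸ ∣ VY ∣) * n ^ (m ∸ ∣ VX ∣))
theorem1p4 m n _ _ VX VY ET tree
  -- With every edge allowed, the upper bound of `Between` is vacuous; `≤-refl` fixes the induction
  -- bound as the successor of the initial weight.
  with τ , card , eq ← count-between _ VX VY ET (complete m n) ≤-refl tree
         (λ i j _ → complete-edge i j) (λ i j _ _ → complete-edge i j)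
  -- The exponents become the numbers of free vertices, the form in which the uniform weights are
  -- evaluated.
  rewrite sym (∣∁p∣≡n∸∣p∣ VX) | sym (∣∁p∣≡n∸∣p∣ VY) =
  τ , card-⇔ (λ S (st , l , _) → st , l) (λ S (st , l) → st , l , λ i j _ → complete-edge i j) card ,
  clear-denominators (∣ VX ∣) (∣ ∁ VX ∣) (∣ VY ∣) (∣ ∁ VY ∣) (∣p∣+∣∁p∣≡n VX) (∣p∣+∣∁p∣≡n VY)
    (trans eq (cong₂ _*_ (prodOff-uniform VX rows) (prodOff-uniform VY cols)))
    (omitOff-uniform VX rows) (omitOff-uniform VY cols)
  where
  rows : ∀ i → i ∉ VX → rowDeg (complete m n) i ≡ n
  rows i _ = rowDeg-complete i
  cols : ∀ j → j ∉ VY → colDeg (complete m n) j ≡ m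
  cols j _ = colDeg-complete j
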